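{- Let $(Co_{\mathbf{K}},i)$ be a congruence filter pair for which the collection of left adjoints $(\Xi_A)_A$ is a natural transformation with respect to variable inclusions, i.e. such that for every inclusion of sets $Z\subseteq X$, with induced map of formula algebras $j_X:Fm(Z)\hookrightarrow Fm(X)$, and every theory $T\subseteq Fm(X)$, $$\Xi_{Fm(Z)}(j_X^{ -1}(T))=(j_X\times j_X)^{ -1}(\Xi_{Fm(X)}(T)).$$ Then $(Co_{\mathbf{K}},i)$ has the theory lifting property.
   Context: $\Sigma$-Str is the category of $\Sigma$-structures and homomorphisms; $Fm(X)$ is the absolutely free $\Sigma$-structure on a set $X$. $AL$ is the category of algebraic lattices with maps preserving arbitrary meets and directed joins. A filter pair over $\Sigma$ is a pair $(G,i)$ of a contravariant functor $G:\Sigma\text{ -Str}\to AL$ and maps $i_A:G(A)\to(\mathcal{P}(A),\subseteq)$, one for each $\Sigma$-structure $A$, preserving arbitrary infima (in particular $i_A(\top)=A$) and directed suprema, such that $i_A\circ G(h)=h^{ -1}\circ i_B$ for every homomorphism $h:A\to B$. $\Xi_A:\mathcal{P}(A)\to G(A)$ is the left adjoint of $i_A$ ($\Xi_A(D)\leq z\iff D\subseteq i_A(z)$). A congruence filter pair is a filter pair $(Co_{\mathbf{K}},i)$ where $\mathbf{K}$ is a class of $\Sigma$-structures such that $A\mapsto Co_{\mathbf{K}}(A)$, the set of congruences $\theta$ on $A$ with $A/\theta\in\mathbf{K}$ ordered by inclusion, together with $f\mapsto(f\times f)^{ -1}$, is a contravariant functor to $AL$ (for example, $\mathbf{K}$ a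 quasivariety). A theory in $Fm(X)$ is a set in the image of $i_{Fm(X)}$; these are exactly the subsets closed under the relation $\vdash^X$ of the associated logic, where $\Gamma\vdash^X\varphi$ iff for every $\theta\in Co_{\mathbf{K}}(Fm(X))$, $\Gamma\subseteq i_{Fm(X)}(\theta)$ implies $\varphi\in i_{Fm(X)}(\theta)$, and they coincide with the filters on $Fm(X)$ of the associated logic $l$ (based on an infinite set of variables). Theory lifting property: for all sets $X,Y$ with $Z:=X\cap Y\neq\emptyset$ and every theory $T\subseteq Fm(X)$, putting $T'':=T\cap Fm(Z)$ and letting $T'\subseteq Fm(Y)$ be the smallest theory in $Fm(Y)$ containing $T''$, there exist $\theta_T\in Co_{\mathbf{K}}(Fm(X))$, $\theta_{T''}\in Co_{\mathbf{K}}(Fm(Z))$, $\theta_{T'}\in Co_{\mathbf{K}}(Fm(Y))$ with (a) $T=i(\theta_T)$, $T'=i(\theta_{T'})$, $T''=i(\theta_{T''})$, and (b) $\theta_T\cap Fm(Z)^2=\theta_{T''}=\theta_{T'}\cap Fm(Z)^2$. -}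

-- Sets are rendered as setoids over Set ℓ, so that quotients A/θ are available, and
-- subsets, relations and collections of elements of a lattice are rendered as
-- predicates with values in Set ℓ.  In a classical metatheory the last choice is no
-- restriction: excluded middle makes every predicate equivalent to an ℓ-valued one.

module Defs where

open import Data.Fin.Base using (Fin)
open import Data.Nat.Base using (ℕ)
open import Data.Product.Base using (Σ-syntax; ∃; ∃-syntax; _×_; _,_; proj₁; proj₂; uncurry)
open import Data.Vec.Functional using (Vector)
open import Function.Base using (_∘_)
open import Function.Bundles using (_⇔_; mk⇔; Equivalence)
open import Level using (Level; _⊔_; suc)
open import Relation.Binary.Bundles using (Setoid; Poset)
open import Relation.Binary.Core using (Rel)
open import Relation.Binary.Definitions using (_Respects_)
open import Relation.Binary.Morphism.Bundles using (PosetHomomorphism; mkPosetHomo)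
open import Relation.Binary.Structures using (IsEquivalence)
open import Relation.Unary using (Pred; _⊆_; Satisfiable; _≐_; _∩_)
import Relation.Binary.Construct.On as On
open import Relation.Unary.Relation.Binary.Subset using (⊆-poset)

------------------------------------------------------------------------
-- Algebraic lattices

module _ {c ℓ₁ ℓ₂ : Level} (P : Poset c ℓ₁ ℓ₂) where
  open Poset P

  IsInf IsSup : {s : Level} → Pred Carrier s → Carrier → Set (c ⊔ ℓ₂ ⊔ s)
  IsInf S m = (∀ x → S x → m ≤ x) × (∀ y → (∀ x → S x → y ≤ x) → y ≤ m)
  IsSup S m = (∀ x → S x → x ≤ m) × (∀ y → (∀ x → S x → x ≤ y) → m ≤ y)

  IsDirected : {s : Level} → Pred Carrier s → Set (c ⊔ ℓ₂ ⊔ s)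
  IsDirected S = Satisfiable S ×
    (∀ x y → S x → S y → ∃[ z ] S z × x ≤ z × y ≤ z)

  IsCompact : (s : Level) → Carrier → Set (c ⊔ ℓ₂ ⊔ suc s)
  IsCompact s a = (S : Pred Carrier s) → IsDirected S →
    ∀ m → IsSup S m → a ≤ m → ∃[ x ] S x × a ≤ x

  record IsAlgebraicLattice (s : Level) : Set (c ⊔ ℓ₂ ⊔ suc s) where
    field
      ⋀         : Pred Carrier s → Carrier
      ⋁         : Pred Carrier s → Carrier
      ⋀-isInf   : ∀ S → IsInf S (⋀ S)
      ⋁-isSup   : ∀ S → IsSup S (⋁ S)
      algebraic : ∀ x → IsSup (λ a → IsCompact s a × a ≤ x) x

record AlgebraicLattice (c ℓ : Level) : Set (suc (c ⊔ ℓ)) where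
  field
    poset              : Poset c ℓ ℓ
    isAlgebraicLattice : IsAlgebraicLattice poset ℓ
  open Poset poset public
  open IsAlgebraicLattice isAlgebraicLattice public

module _ {c₁ c₂ ℓ₁ ℓ₂ ℓ₃ ℓ₄ : Level} {P : Poset c₁ ℓ₁ ℓ₂} {Q : Poset c₂ ℓ₃ ℓ₄} where
  private
    module P = Poset P
    module Q = Poset Q

  image : {s : Level} → (P.Carrier → Q.Carrier) → Pred P.Carrier s → Pred Q.Carrier (c₁ ⊔ ℓ₃ ⊔ s)
  image f S y = ∃[ x ] S x × y Q.≈ f x

  record PreservesMeetsAndDirectedJoins (s : Level) (f : P.Carrier → Q.Carrier)
         : Set (c₁ ⊔ c₂ ⊔ ℓ₂ ⊔ ℓ₃ ⊔ ℓ₄ ⊔ suc s) where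
    field
      meets         : (S : Pred P.Carrier s) → ∀ m → IsInf P S m → IsInf Q (image f S) (f m)
      directedJoins : (S : Pred P.Carrier s) → IsDirected P S →
                      ∀ m → IsSup P S m → IsSup Q (image f S) (f m)

-- Maps preserving arbitrary meets and directed joins.  The domain and codomain are
-- allowed to be arbitrary posets because the maps i_A : G(A) → 𝒫(A) of a filter pair
-- are of the same kind as the morphisms of AL.
record ALMap {c₁ c₂ ℓ₁ ℓ₂ ℓ₃ ℓ₄ : Level} (s : Level)
             (P : Poset c₁ ℓ₁ ℓ₂) (Q : Poset c₂ ℓ₃ ℓ₄)
             : Set (c₁ ⊔ c₂ ⊔ ℓ₁ ⊔ ℓ₂ ⊔ ℓ₃ ⊔ ℓ₄ ⊔ suc s) where
  field
    homo      : PosetHomomorphism P Q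
  open PosetHomomorphism homo public
  field
    preserves : PreservesMeetsAndDirectedJoins {P = P} {Q = Q} s ⟦_⟧
  open PreservesMeetsAndDirectedJoins preserves public

------------------------------------------------------------------------
-- Subsets of a setoid

record Subset {ℓ : Level} (S : Setoid ℓ ℓ) : Set (suc ℓ) where
  open Setoid S
  field
    pred : Pred Carrier ℓ
    resp : pred Respects _≈_

open Subset public

module _ {ℓ : Level} where

  𝒫 : Setoid ℓ ℓ → Poset (suc ℓ) ℓ ℓ
  𝒫 S = On.poset (⊆-poset (Setoid.Carrier S) ℓ) (pred {S = S})

  infix 4 _⊑_ _≑_
  _⊑_ _≑_ : {S : Setoid ℓ ℓ} → Subset S → Subset S → Set ℓ
  D ⊑ E = pred D ⊆ pred E
  D ≑ E = pred D ≐ pred E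

  infixr 7 _⊓_
  _⊓_ : {S : Setoid ℓ ℓ} → Subset S → Subset S → Subset S
  D ⊓ E = record
    { pred = pred D ∩ pred E
    ; resp = λ x≈y (x∈D , x∈E) → resp D x≈y x∈D , resp E x≈y x∈E
    }

  asSetoid : {S : Setoid ℓ ℓ} → Subset S → Setoid ℓ ℓ
  asSetoid {S} D = On.setoid {B = ∃ (pred D)} S proj₁

------------------------------------------------------------------------
-- Σ-structures; Op n is the set of n-ary function symbols

Signature : (ℓ : Level) → Set (suc ℓ)
Signature ℓ = ℕ → Set ℓ

record Structure {ℓ : Level} (Op : Signature ℓ) : Set (suc ℓ) where
  field
    setoid : Setoid ℓ ℓ
  open Setoid setoid public
  field
    op      : ∀ {n} → Op n → Vector Carrier n → Carrier
    op-cong : ∀ {n} (f : Op n) {xs ys : Vector Carrier n} →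
              (∀ j → xs j ≈ ys j) → op f xs ≈ op f ys

module _ {ℓ : Level} {Op : Signature ℓ} where

  record Hom (A B : Structure Op) : Set ℓ where
    private
      module A = Structure A
      module B = Structure B
    field
      ⟦_⟧  : A.Carrier → B.Carrier
      cong : ∀ {x y} → x A.≈ y → ⟦ x ⟧ B.≈ ⟦ y ⟧
      hom  : ∀ {n} (f : Op n) (xs : Vector A.Carrier n) →
             ⟦ A.op f xs ⟧ B.≈ B.op f (⟦_⟧ ∘ xs)

  open Hom public using (⟦_⟧)

  infix 4 _≗_
  _≗_ : {A B : Structure Op} → Hom A B → Hom A B → Set ℓ
  _≗_ {B = B} f g = ∀ x → Structure._≈_ B (⟦ f ⟧ x) (⟦ g ⟧ x)

  idHom : {A : Structure Op} → Hom A A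
  idHom {A} = record { ⟦_⟧ = λ x → x ; cong = λ p → p ; hom = λ _ _ → Structure.refl A }

  infixr 9 _∘ₕ_
  _∘ₕ_ : {A B C : Structure Op} → Hom B C → Hom A B → Hom A C
  _∘ₕ_ {C = C} g f = record
    { ⟦_⟧  = ⟦ g ⟧ ∘ ⟦ f ⟧
    ; cong = Hom.cong g ∘ Hom.cong f
    ; hom  = λ o xs → Structure.trans C (Hom.cong g (Hom.hom f o xs)) (Hom.hom g o (⟦ f ⟧ ∘ xs))
    }

  infix 8 _⁻¹[_]
  _⁻¹[_] : {A B : Structure Op} → Hom A B →
           Subset (Structure.setoid B) → Subset (Structure.setoid A)
  h ⁻¹[ D ] = record
    { pred = pred D ∘ ⟦ h ⟧
    ; resp = resp D ∘ Hom.cong h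
    }

------------------------------------------------------------------------
-- The absolutely free Σ-structure

  data Term (X : Set ℓ) : Set ℓ where
    var  : X → Term X
    node : ∀ {n} → Op n → Vector (Term X) n → Term X

  -- Syntactic equality of terms, up to the given equality of variables.
  data TermEq (X : Setoid ℓ ℓ) : Rel (Term (Setoid.Carrier X)) ℓ where
    var  : ∀ {x y} → Setoid._≈_ X x y → TermEq X (var x) (var y)
    node : ∀ {n} (f : Op n) {ts us : Vector (Term (Setoid.Carrier X)) n} →
           (∀ j → TermEq X (ts j) (us j)) → TermEq X (node f ts) (node f us)

  module _ (X : Setoid ℓ ℓ) where
    private
      module X = Setoid X

    TermEq-refl : ∀ t → TermEq X t t
    TermEq-refl (var x)     = var X.refl
    TermEq-refl (node f ts) = node f (λ j → TermEq-refl (ts j))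

    TermEq-sym : ∀ {t u} → TermEq X t u → TermEq X u t
    TermEq-sym (var p)     = var (X.sym p)
    TermEq-sym (node f ps) = node f (λ j → TermEq-sym (ps j))

    TermEq-trans : ∀ {t u v} → TermEq X t u → TermEq X u v → TermEq X t v
    TermEq-trans (var p)     (var q)      = var (X.trans p q)
    TermEq-trans (node f ps) (node .f qs) = node f (λ j → TermEq-trans (ps j) (qs j))

    Fm : Structure Op
    Fm = record
      { setoid  = record
        { Carrier       = Term X.Carrier
        ; _≈_           = TermEq X
        ; isEquivalence = record
          { refl = TermEq-refl _ ; sym = TermEq-sym ; trans = TermEq-trans } }
      ; op      = node
      ; op-cong = node
      }

  rename : {X Y : Set ℓ} → (X → Y) → Term X → Term Y
  rename r (var x)     = var (r x)
  rename r (node f ts) = node f (λ j → rename r (ts j))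

  module _ {U : Setoid ℓ ℓ} where

    Fm⟨_⟩ : Subset U → Structure Op
    Fm⟨ X ⟩ = Fm (asSetoid X)

    private
      include : {Z X : Subset U} → Z ⊑ X → ∃ (pred Z) → ∃ (pred X)
      include Z⊑X (x , x∈Z) = x , Z⊑X x∈Z

      include-cong : {Z X : Subset U} (Z⊑X : Z ⊑ X) → ∀ {t u} → TermEq (asSetoid Z) t u →
        TermEq (asSetoid X) (rename (include {Z} {X} Z⊑X) t) (rename (include {Z} {X} Z⊑X) u)
      include-cong             Z⊑X (var p)     = var p
      include-cong {Z} {X} Z⊑X (node f ps) = node f (λ j → include-cong {Z} {X} Z⊑X (ps j))

    inclusion : {Z X : Subset U} → Z ⊑ X → Hom Fm⟨ Z ⟩ Fm⟨ X ⟩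
    inclusion {Z} {X} Z⊑X = record
      { ⟦_⟧  = rename (include {Z} {X} Z⊑X)
      ; cong = include-cong {Z} {X} Z⊑X
      ; hom  = λ _ _ → TermEq-refl (asSetoid X) _
      }

------------------------------------------------------------------------
-- Congruences

  record Congruence (A : Structure Op) : Set (suc ℓ) where
    open Structure A
    field
      rel           : Rel Carrier ℓ
      isEquivalence : IsEquivalence rel
      ≈⇒rel         : ∀ {x y} → x ≈ y → rel x y
      compatible    : ∀ {n} (f : Op n) {xs ys : Vector Carrier n} →
                      (∀ j → rel (xs j) (ys j)) → rel (op f xs) (op f ys)

  open Congruence public using (rel)

  infix 9 _/_
  _/_ : (A : Structure Op) → Congruence A → Structure Op
  A / θ = record
    { setoid  = record { isEquivalence = Congruence.isEquivalence θ }
    ; op      = Structure.op A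
    ; op-cong = Congruence.compatible θ
    }

  -- (f × f)⁻¹
  pullback : {A B : Structure Op} → Hom A B → Congruence B → Congruence A
  pullback f θ = record
    { rel           = λ x y → rel θ (⟦ f ⟧ x) (⟦ f ⟧ y)
    ; isEquivalence = On.isEquivalence ⟦ f ⟧ θ.isEquivalence
    ; ≈⇒rel         = λ p → θ.≈⇒rel (Hom.cong f p)
    ; compatible    = λ o {xs} {ys} ps →
        θ.trans (θ.≈⇒rel (Hom.hom f o xs))
          (θ.trans (θ.compatible o ps) (θ.sym (θ.≈⇒rel (Hom.hom f o ys))))
    }
    where
    module θ where
      open Congruence θ public
      open IsEquivalence (Congruence.isEquivalence θ) public

------------------------------------------------------------------------
-- Filter pairs

  record ContravariantFunctor (c : Level) : Set (suc (c ⊔ ℓ)) where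
    field
      obj : Structure Op → AlgebraicLattice c ℓ
    module obj (A : Structure Op) = AlgebraicLattice (obj A)
    field
      map      : ∀ {A B} → Hom A B → ALMap ℓ (obj.poset B) (obj.poset A)
      map-cong : ∀ {A B} {f g : Hom A B} → f ≗ g →
                 ∀ z → obj._≈_ A (ALMap.⟦_⟧ (map f) z) (ALMap.⟦_⟧ (map g) z)
      map-id   : ∀ {A} z → obj._≈_ A (ALMap.⟦_⟧ (map (idHom {A})) z) z
      map-∘    : ∀ {A B C} (g : Hom B C) (f : Hom A B) z →
                 obj._≈_ A (ALMap.⟦_⟧ (map (g ∘ₕ f)) z)
                           (ALMap.⟦_⟧ (map f) (ALMap.⟦_⟧ (map g) z))

  record FilterPair {c : Level} (G : ContravariantFunctor c) : Set (suc (c ⊔ ℓ)) where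
    open ContravariantFunctor G
    field
      iMap : ∀ A → ALMap ℓ (obj.poset A) (𝒫 (Structure.setoid A))

    i : ∀ A → obj.Carrier A → Subset (Structure.setoid A)
    i A = ALMap.⟦_⟧ (iMap A)

    field
      natural : ∀ {A B} (h : Hom A B) z → i A (ALMap.⟦_⟧ (map h) z) ≑ h ⁻¹[ i B z ]

    Ξ : ∀ A → Subset (Structure.setoid A) → obj.Carrier A
    Ξ A D = obj.⋀ A (λ z → D ⊑ i A z)

    Ξ-leftAdjoint : ∀ A D z → obj._≤_ A (Ξ A D) z ⇔ D ⊑ i A z
    Ξ-leftAdjoint A D z = mk⇔ to from
      where
      S = λ z → D ⊑ i A z
      unit : D ⊑ i A (Ξ A D)
      unit = proj₂ (ALMap.meets (iMap A) S (Ξ A D) (obj.⋀-isInf A S)) D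
               (λ E (z , D⊑iz , E≑iz) x∈D → proj₂ E≑iz (D⊑iz x∈D))
      to : obj._≤_ A (Ξ A D) z → D ⊑ i A z
      to Ξ≤z x∈D = ALMap.mono (iMap A) Ξ≤z (unit x∈D)
      from : D ⊑ i A z → obj._≤_ A (Ξ A D) z
      from D⊑iz = proj₁ (obj.⋀-isInf A S) z D⊑iz

    IsTheory : {X : Setoid ℓ ℓ} → Subset (Structure.setoid (Fm X)) → Set (c ⊔ ℓ)
    IsTheory {X} T = ∃[ z ] i (Fm X) z ≑ T

    IsSmallestTheoryContaining : {X : Setoid ℓ ℓ} →
      Subset (Structure.setoid (Fm X)) → Pred (Structure.Carrier (Fm X)) ℓ → Set (c ⊔ suc ℓ)
    IsSmallestTheoryContaining {X} T D =
      IsTheory T × D ⊆ pred T ×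
      ((T₁ : Subset (Structure.setoid (Fm X))) → IsTheory T₁ → D ⊆ pred T₁ → T ⊑ T₁)

    smallestTheory : {X : Setoid ℓ ℓ} (D : Subset (Structure.setoid (Fm X))) →
      IsSmallestTheoryContaining (i (Fm X) (Ξ (Fm X) D)) (pred D)
    smallestTheory {X} D =
      (Ξ (Fm X) D , (λ p → p) , (λ p → p)) ,
      Equivalence.to (Ξ-leftAdjoint (Fm X) D (Ξ (Fm X) D)) (obj.refl (Fm X)) ,
      λ { T₁ (z , iz⊆T₁ , T₁⊆iz) D⊆T₁ p → iz⊆T₁ (ALMap.mono (iMap (Fm X))
            (Equivalence.from (Ξ-leftAdjoint (Fm X) D z) (λ q → T₁⊆iz (D⊆T₁ q))) p) }

------------------------------------------------------------------------
-- Congruence filter pairs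

  -- No closure property of 𝐊 is assumed, not even under isomorphism.
  module _ {k : Level} (𝐊 : Structure Op → Set k) where

    CoCarrier : Structure Op → Set (suc ℓ ⊔ k)
    CoCarrier A = Σ[ θ ∈ Congruence A ] 𝐊 (A / θ)

    CoPoset : Structure Op → Poset (suc ℓ ⊔ k) ℓ ℓ
    CoPoset A = On.poset {B = CoCarrier A} (⊆-poset (Carrier × Carrier) ℓ) (uncurry ∘ rel ∘ proj₁)
      where open Structure A

    record IsCoFunctorial : Set (suc (suc ℓ ⊔ k)) where
      field
        isAlgebraicLattice : ∀ A → IsAlgebraicLattice (CoPoset A) ℓ
        pullback-closed    : ∀ {A B} (f : Hom A B) (θ : Congruence B) →
                             𝐊 (B / θ) → 𝐊 (A / pullback f θ)

      Co-map : ∀ {A B} → Hom A B → CoCarrier B → CoCarrier A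
      Co-map f (θ , B/θ∈𝐊) = pullback f θ , pullback-closed f θ B/θ∈𝐊

      field
        pullback-preserves : ∀ {A B} (f : Hom A B) →
          PreservesMeetsAndDirectedJoins {P = CoPoset B} {Q = CoPoset A} ℓ (Co-map f)

    Co : IsCoFunctorial → ContravariantFunctor (suc ℓ ⊔ k)
    Co functorial = record
      { obj      = λ A → record
        { poset              = CoPoset A
        ; isAlgebraicLattice = isAlgebraicLattice A }
      ; map      = λ {A} {B} f → record
        { homo      = mkPosetHomo (CoPoset B) (CoPoset A) (Co-map f) (λ θ⊆φ → θ⊆φ)
        ; preserves = pullback-preserves f }
      ; map-cong = λ {A} {B} {f} {g} f≗g (θ , _) →
          let open Congruence θ using (≈⇒rel; isEquivalence)
              open IsEquivalence isEquivalence
              f~g : ∀ x → rel θ (⟦ f ⟧ x) (⟦ g ⟧ x)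
              f~g x = ≈⇒rel (f≗g x)
          in (λ {(x , y)} p → trans (sym (f~g x)) (trans p (f~g y)))
           , (λ {(x , y)} p → trans (f~g x) (trans p (sym (f~g y))))
      ; map-id   = λ _ → (λ p → p) , (λ p → p)
      ; map-∘    = λ _ _ _ → (λ p → p) , (λ p → p)
      }
      where open IsCoFunctorial functorial

record CongruenceFilterPair {ℓ : Level} (Op : Signature ℓ) (k : Level) : Set (suc (suc ℓ ⊔ k)) where
  field
    𝐊          : Structure Op → Set k
    functorial : IsCoFunctorial 𝐊
    filterPair : FilterPair (Co 𝐊 functorial)

  open ContravariantFunctor (Co 𝐊 functorial) public
  open FilterPair filterPair public

  Co𝐊 : Structure Op → Set (suc ℓ ⊔ k)
  Co𝐊 = CoCarrier 𝐊

  infix 4 _≋_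
  _≋_ : {A : Structure Op} → Co𝐊 A → Co𝐊 A → Set ℓ
  _≋_ {A} = Poset._≈_ (CoPoset 𝐊 A)

  -- For an inclusion of formula algebras j : Fm(Z) → Fm(X), this is θ ∩ Fm(Z)².
  infix 8 _²⁻¹[_]
  _²⁻¹[_] : {A B : Structure Op} → Hom A B → Co𝐊 B → Co𝐊 A
  f ²⁻¹[ θ ] = IsCoFunctorial.Co-map functorial f θ

-- Sets of variables are given as subsets of an arbitrary ambient set U, so that
-- inclusions and intersections of them make sense.  The smallest theory T′ is unique
-- up to ≑ and exists by smallestTheory, so quantifying over it only names it.
module _ {ℓ k : Level} {Op : Signature ℓ} (𝔽 : CongruenceFilterPair Op k) where
  open CongruenceFilterPair 𝔽

  ΞNaturalForInclusions : Set (suc ℓ ⊔ k)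
  ΞNaturalForInclusions =
    (U : Setoid ℓ ℓ) (Z X : Subset U) (Z⊑X : Z ⊑ X) →
    let j = inclusion {U = U} {Z} {X} Z⊑X in
    (T : Subset (Structure.setoid Fm⟨ X ⟩)) → IsTheory T →
    Ξ Fm⟨ Z ⟩ (j ⁻¹[ T ]) ≋ j ²⁻¹[ Ξ Fm⟨ X ⟩ T ]

  TheoryLiftingProperty : Set (suc ℓ ⊔ k)
  TheoryLiftingProperty =
    (U : Setoid ℓ ℓ) (X Y : Subset U) →
    let Z  = X ⊓ Y
        jX = inclusion {U = U} {Z} {X} proj₁
        jY = inclusion {U = U} {Z} {Y} proj₂
    in Satisfiable (pred Z) →
    (T : Subset (Structure.setoid Fm⟨ X ⟩)) → IsTheory T →
    let T″ = jX ⁻¹[ T ] in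
    (T′ : Subset (Structure.setoid Fm⟨ Y ⟩)) →
    IsSmallestTheoryContaining T′ (λ u → ∃[ t ] pred T″ t × Structure._≈_ Fm⟨ Y ⟩ u (⟦ jY ⟧ t)) →
    Σ[ θT  ∈ Co𝐊 Fm⟨ X ⟩ ]
    Σ[ θT″ ∈ Co𝐊 Fm⟨ Z ⟩ ]
    Σ[ θT′ ∈ Co𝐊 Fm⟨ Y ⟩ ]
      (T ≑ i Fm⟨ X ⟩ θT × T′ ≑ i Fm⟨ Y ⟩ θT′ × T″ ≑ i Fm⟨ Z ⟩ θT″) ×
      (jX ²⁻¹[ θT ] ≋ θT″ × θT″ ≋ jY ²⁻¹[ θT′ ])

{-# OPTIONS --safe #-}
-- Take θ = Ξ(T), Ξ(T″), Ξ(T′).  By naturality of Ξ both restrictions to Fm(Z) are as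
-- required once T′ is conservative over T″, that is j_Y⁻¹(T′) = T″.  For this, a
-- retraction r of Y onto the nonempty set Z makes r⁻¹(T″) a theory containing T″, so
-- that T′ ⊆ r⁻¹(T″); now intersect with Fm(Z).
module Submission where

open import Defs
open import Axiom.ExcludedMiddle using (ExcludedMiddle)
open import Data.Product.Base using (∃; ∃-syntax; _×_; _,_; proj₁; proj₂; swap)
open import Function.Base using (_∘_)
open import Function.Bundles using (_⟶ₛ_; Func; Equivalence)
open import Level using (Level)
open import Relation.Binary.Bundles using (Setoid)
open import Relation.Nullary using (yes; no; contradiction)
open import Relation.Unary using (Satisfiable)

module _ {ℓ : Level} {Op : Signature ℓ} where

  renameHom : {X Y : Setoid ℓ ℓ} → X ⟶ₛ Y → Hom {Op = Op} (Fm X) (Fm Y)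
  renameHom {X} {Y} r = record
    { ⟦_⟧  = rename r.to
    ; cong = rename-cong
    ; hom  = λ _ _ → TermEq-refl Y _
    }
    where
    module r = Func r
    rename-cong : ∀ {t u} → TermEq X t u → TermEq Y (rename r.to t) (rename r.to u)
    rename-cong (var p)     = var (r.cong p)
    rename-cong (node f ps) = node f (λ j → rename-cong (ps j))

  module _ {U : Setoid ℓ ℓ} {Z Y : Subset U} (Z⊑Y : Z ⊑ Y) where
    private
      module Z = Setoid (asSetoid Z)

    -- Renaming touches only the leaves, and `TermEq` compares argument vectors pointwise, so a
    -- retraction of variables extends to terms by induction.
    rename-inclusion : (r : asSetoid Y ⟶ₛ asSetoid Z) →
      (∀ x x∈Z → Func.to r (x , Z⊑Y x∈Z) Z.≈ (x , x∈Z)) →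
      renameHom r ∘ₕ inclusion {U = U} {Z} {Y} Z⊑Y ≗ idHom
    rename-inclusion r retracts (var (x , x∈Z)) = var (retracts x x∈Z)
    rename-inclusion r retracts (node f ts)     =
      node f (λ j → rename-inclusion r retracts (ts j))

module _ {ℓ : Level} (em : ExcludedMiddle ℓ) {U : Setoid ℓ ℓ} {Z Y : Subset U} where
  private
    module U = Setoid U
    module Z = Setoid (asSetoid Z)

  -- Excluded middle decides membership in `Z`. Membership proofs may vary freely, since `asSetoid`
  -- compares underlying elements only.
  retraction : Z ⊑ Y → Satisfiable (pred Z) →
    ∃[ r ] (∀ x (x∈Z : pred Z x) (x∈Y : pred Y x) →
      Func.to {From = asSetoid Y} {To = asSetoid Z} r (x , x∈Y) Z.≈ (x , x∈Z))
  retraction Z⊑Y z₀ = record { to = to ; cong = to-cong } , retracts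
    where
    to : ∃ (pred Y) → ∃ (pred Z)
    to (x , _) with em {P = pred Z x}
    ... | yes x∈Z = x , x∈Z
    -- Nonemptiness of `Z` supplies this default value for every element outside `Z`.
    ... | no  _   = z₀

    to-cong : ∀ {p q} → proj₁ p U.≈ proj₁ q → to p Z.≈ to q
    to-cong {x , _} {y , _} x≈y with em {P = pred Z x} | em {P = pred Z y}
    ... | yes _   | yes _   = x≈y
    -- The two mixed cases are impossible because `Z` respects the equality of `U`.
    ... | yes x∈Z | no  y∉Z = contradiction (resp Z x≈y x∈Z) y∉Z
    ... | no  x∉Z | yes y∈Z = contradiction (resp Z (U.sym x≈y) y∈Z) x∉Z
    ... | no  _   | no  _   = U.refl

    retracts : ∀ x (x∈Z : pred Z x) (x∈Y : pred Y x) → to (x , x∈Y) Z.≈ (x , x∈Z)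
    retracts x x∈Z _ with em {P = pred Z x}
    ... | yes _   = U.refl
    ... | no  x∉Z = contradiction x∈Z x∉Z

module _ {ℓ c : Level} {Op : Signature ℓ} {G : ContravariantFunctor {Op = Op} c}
         (P : FilterPair G) where
  open ContravariantFunctor G
  open FilterPair P

  Ξ-unit : ∀ A D → D ⊑ i A (Ξ A D)
  Ξ-unit A D = Equivalence.to (Ξ-leftAdjoint A D (Ξ A D)) (obj.refl A)

  Ξ-mono : ∀ A {D E} → D ⊑ E → obj._≤_ A (Ξ A D) (Ξ A E)
  Ξ-mono A {D} {E} D⊑E =
    Equivalence.from (Ξ-leftAdjoint A D (Ξ A E)) (Ξ-unit A E ∘ D⊑E)

  -- One inclusion is the unit of the adjunction. For the other, write `T` as `i z`: the adjunction
  -- puts `Ξ T` below `z`, and `i` is monotone.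
  theory≑iΞ : {X : Setoid ℓ ℓ} (T : Subset (Structure.setoid (Fm X))) → IsTheory T →
    T ≑ i (Fm X) (Ξ (Fm X) T)
  theory≑iΞ {X} T (z , iz⊑T , T⊑iz) =
    Ξ-unit (Fm X) T ,
    iz⊑T ∘ ALMap.mono (iMap (Fm X)) (Equivalence.from (Ξ-leftAdjoint (Fm X) T z) T⊑iz)

  -- By naturality of `i`, if `z` witnesses `T` then `map h z` witnesses the preimage. This serves
  -- both for variable inclusions and for the substitution `ρ`.
  preimage-isTheory : {X Y : Setoid ℓ ℓ} (h : Hom (Fm X) (Fm Y)) →
    (T : Subset (Structure.setoid (Fm Y))) → IsTheory T → IsTheory (h ⁻¹[ T ])
  preimage-isTheory h T (z , iz⊑T , T⊑iz) =
    ALMap.⟦_⟧ (map h) z ,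
    iz⊑T ∘ proj₁ (natural h z) ,
    proj₂ (natural h z) ∘ T⊑iz

  smallestTheory-conservative : ExcludedMiddle ℓ →
    {U : Setoid ℓ ℓ} {Z Y : Subset U} (Z⊑Y : Z ⊑ Y) → Satisfiable (pred Z) →
    let j = inclusion {U = U} {Z} {Y} Z⊑Y in
    (T : Subset (Structure.setoid Fm⟨ Z ⟩)) → IsTheory T →
    (T′ : Subset (Structure.setoid Fm⟨ Y ⟩)) →
    IsSmallestTheoryContaining T′ (λ u → ∃[ t ] pred T t × Structure._≈_ Fm⟨ Y ⟩ u (⟦ j ⟧ t)) →
    j ⁻¹[ T′ ] ≑ T
  smallestTheory-conservative em {U} {Z} {Y} Z⊑Y Z≢∅ T T-theory T′ (_ , T⊆T′ , T′-least)
    with r , r-retracts ← retraction em {Z = Z} {Y} Z⊑Y Z≢∅ =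
    -- Minimality of `T′` places `ρ (j t)` in `T`; this term is only syntactically equal to `t`, so
    -- membership is transported along `ρj≗id`.
    (λ {t} jt∈T′ → resp T (ρj≗id t)
      (T′-least (ρ ⁻¹[ T ]) (preimage-isTheory ρ T T-theory) T⊆ρ⁻¹T jt∈T′)) ,
    (λ {t} t∈T → T⊆T′ (t , t∈T , Y.refl))
    where
    module Y = Structure (Fm⟨_⟩ {Op = Op} Y)
    module Z = Structure (Fm⟨_⟩ {Op = Op} Z)

    j : Hom Fm⟨ Z ⟩ Fm⟨ Y ⟩
    j = inclusion {U = U} {Z} {Y} Z⊑Y

    ρ : Hom Fm⟨ Y ⟩ Fm⟨ Z ⟩
    ρ = renameHom r

    ρj≗id : ρ ∘ₕ j ≗ idHom
    ρj≗id = rename-inclusion {Z = Z} {Y} Z⊑Y r (λ x x∈Z → r-retracts x x∈Z (Z⊑Y x∈Z))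

    T⊆ρ⁻¹T : ∀ {u} → ∃[ t ] pred T t × u Y.≈ ⟦ j ⟧ t → pred T (⟦ ρ ⟧ u)
    T⊆ρ⁻¹T (t , t∈T , u≈jt) =
      resp T (Z.sym (Z.trans (Hom.cong ρ u≈jt) (ρj≗id t))) t∈T

lemma5p6 : {ℓ k : Level} → ExcludedMiddle ℓ →
    (Op : Signature ℓ) (𝔽 : CongruenceFilterPair Op k) →
    ΞNaturalForInclusions 𝔽 → TheoryLiftingProperty 𝔽
lemma5p6 em Op 𝔽 Ξ-natural U X Y Z≢∅ T T-theory T′ T′-smallest =
  Ξ Fm⟨ X ⟩ T , Ξ Fm⟨ Z ⟩ T″ , Ξ Fm⟨ Y ⟩ T′ ,
  (theory≑iΞ F T T-theory , theory≑iΞ F T′ T′-theory , theory≑iΞ F T″ T″-theory) ,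
  -- `T″` is by definition the preimage of `T`, so naturality applies directly; `≋` is a pair of
  -- inclusions, and swapping them reverses it.
  swap (Ξ-natural U Z X proj₁ T T-theory) ,
  -- Naturality speaks of the preimage of `T′`. Conservativity and monotonicity of `Ξ` in both
  -- directions first replace `T″` by that preimage.
  Co.Eq.trans {i = Ξ Fm⟨ Z ⟩ T″} {j = Ξ Fm⟨ Z ⟩ (jY ⁻¹[ T′ ])} {k = jY ²⁻¹[ Ξ Fm⟨ Y ⟩ T′ ]}
    (Ξ-mono F Fm⟨ Z ⟩ {T″} {jY ⁻¹[ T′ ]} T″⊑T′ , Ξ-mono F Fm⟨ Z ⟩ {jY ⁻¹[ T′ ]} {T″} T′⊑T″)
    (Ξ-natural U Z Y proj₂ T′ T′-theory)
  where
  open CongruenceFilterPair 𝔽 renaming (filterPair to F)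

  Z : Subset U
  Z = X ⊓ Y

  module Co = ContravariantFunctor.obj (Co 𝐊 functorial) Fm⟨ Z ⟩

  jX : Hom Fm⟨ Z ⟩ Fm⟨ X ⟩
  jX = inclusion {U = U} {Z} {X} proj₁

  jY : Hom Fm⟨ Z ⟩ Fm⟨ Y ⟩
  jY = inclusion {U = U} {Z} {Y} proj₂

  T″ : Subset (Structure.setoid Fm⟨ Z ⟩)
  T″ = jX ⁻¹[ T ]

  T″-theory : IsTheory T″
  T″-theory = preimage-isTheory F jX T T-theory

  T′-theory : IsTheory T′
  T′-theory = proj₁ T′-smallest

  T′≑T″ : jY ⁻¹[ T′ ] ≑ T″
  T′≑T″ = smallestTheory-conservative F em {Z = Z} {Y} proj₂ Z≢∅ T″ T″-theory T′ T′-smallest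

  T′⊑T″ : jY ⁻¹[ T′ ] ⊑ T″
  T′⊑T″ = proj₁ T′≑T″

  T″⊑T′ : T″ ⊑ jY ⁻¹[ T′ ]
  T″⊑T′ = proj₂ T′≑T″
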